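{- A collection $B$ of patterns has a limit sequence if and only if $B$ contains a pattern $p$ such that $\mathrm{inv}(p)\le 1$.
   Context: A pattern is a (nonempty) permutation. A permutation $\pi$ contains a pattern $p$ if $\pi$ has a subsequence order-isomorphic to $p$; otherwise it avoids $p$. $\mathrm{inv}(\pi)$ is the number of inversions of $\pi$, i.e. pairs $i<j$ with $\pi_i>\pi_j$. $\mathrm{av}_n^k(B)$ is the number of permutations in $S_n$ with exactly $k$ inversions avoiding every pattern in $B$. $B$ has a limit sequence if for every $k\ge 0$ there exist constants $m_k$ and $c_k$ such that $\mathrm{av}_n^k(B)=c_k$ for all $n\ge m_k$. -}

module Defs where

open import Level using (Level; 0ℓ)
open import Data.Nat using (ℕ; suc; _≥_)
open import Data.Fin using (Fin; _<_)
open import Data.Fin.Properties using (_<?_)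
open import Data.Fin.Permutation using (Permutation′; _⟨$⟩ʳ_)
open import Data.List using (length; filter; allFin; cartesianProduct)
open import Data.Product using (Σ; ∃₂; _×_; _,_; proj₁)
open import Function.Bundles using (_⇔_; Inverse)
open import Relation.Binary.Bundles using (Setoid)
open import Relation.Binary.Core using (_Preserves_⟶_)
import Relation.Binary.Construct.On as On
open import Relation.Binary.PropositionalEquality using (_≡_; setoid; _→-setoid_)
open import Relation.Nullary using (¬_)
open import Relation.Nullary.Decidable using (_×-dec_)
open import Relation.Unary using (Pred)

private
  variable
    ℓ : Level
    m n : ℕ

inv : Permutation′ n → ℕ
inv {n} π =
  length (filter (λ (i , j) → (i <? j) ×-dec ((π ⟨$⟩ʳ j) <? (π ⟨$⟩ʳ i)))
                 (cartesianProduct (allFin n) (allFin n)))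

-- f lists the positions of a subsequence of π that is order-isomorphic to p.
Contains : Permutation′ n → Permutation′ m → Set
Contains {n} {m} π p =
  Σ (Fin m → Fin n) λ f →
    (f Preserves _<_ ⟶ _<_) ×
    (∀ i j → (p ⟨$⟩ʳ i) < (p ⟨$⟩ʳ j) ⇔ (π ⟨$⟩ʳ f i) < (π ⟨$⟩ʳ f j))

-- Patterns are nonempty, hence suc.
Pattern : Set
Pattern = Σ ℕ λ m → Permutation′ (suc m)

-- A collection B need not respect pointwise equality of permutations.
-- Nothing depends on this: inv p and Contains π p only see the values of p.
AvoidsAll : Pred Pattern ℓ → Permutation′ n → Set ℓ
AvoidsAll B π = ∀ m p → B (m , p) → ¬ Contains π p

-- Two elements are identified when their permutations agree pointwise; the
-- inverse functions and the proofs stored in them are ignored.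
AvSetoid : Pred Pattern ℓ → (n k : ℕ) → Setoid ℓ 0ℓ
AvSetoid B n k =
  On.setoid {B = Σ (Permutation′ n) λ π → inv π ≡ k × AvoidsAll B π}
            (Fin n →-setoid Fin n) (λ x → proj₁ x ⟨$⟩ʳ_)

-- The cardinality av_n^k(B) as a relation, since B is not assumed decidable:
-- AvCount B n k c says that av_n^k(B) = c.
AvCount : Pred Pattern ℓ → (n k c : ℕ) → Set ℓ
AvCount B n k c = Inverse (setoid (Fin c)) (AvSetoid B n k)

HasLimitSequence : Pred Pattern ℓ → Set ℓ
HasLimitSequence B =
  ∀ k → ∃₂ λ m c → ∀ n → n ≥ m → AvCount B n k c

{-# OPTIONS --safe #-}
-- If no pattern of B has at most one inversion, then no adjacent transposition contains a pattern of
-- B, since containment cannot increase inv; hence av_n^1(B) = n − 1 is not eventually constant.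
--
-- Conversely let p ∈ B with inv p ≤ 1, and put L = |p| + 2k. At most 2k positions of a permutation
-- with k inversions are involved in an inversion, so there are |p| uninvolved ("clean") positions
-- among any L consecutive ones. If position L of π ∈ S_{n+1}, with n ≥ 2L, were involved in an
-- inversion, that inversion together with clean positions before and after it would contain p. So
-- if π avoids B, then position L is a fixed point in no inversion, and deleting it embeds the
-- permutations counted by av_{n+1}^k(B) into those counted by av_n^k(B). A sequence of natural
-- numbers that is eventually non-increasing is eventually constant.
module Submission where

open import Defs
open import Axiom.ExcludedMiddle using (ExcludedMiddle)
open import Data.Nat using (_≤_)
open import Data.Product using (∃₂; _×_; _,_)
open import Function.Bundles using (_⇔_)
open import Relation.Unary using (Pred)

open import Level using (Level; 0ℓ; Lift; lift)
open import Data.Empty using (⊥-elim)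
open import Data.Fin
  using (Fin; zero; suc; toℕ; fromℕ<; inject; inject₁; inject≤; punchIn; punchOut;
         combine; funToFin; finToFun; _<_)
open import Data.Fin.Properties as Fin
  using (_<?_; _≟_; <-cmp; any?; toℕ-injective; toℕ-fromℕ<; toℕ-inject; toℕ-inject≤; toℕ<n;
         injective⇒≤; finToFun-funToFin; punchIn-cancel-≤; punchIn-mono-≤; punchIn-punchOut)
open import Data.Fin.Permutation
  using (Permutation′; _⟨$⟩ʳ_; _⟨$⟩ˡ_; inverseˡ; inverseʳ; flip; id; swap; lift₀; remove; punchIn-permute)
open import Data.List using (List; lookup; filter; allFin; cartesianProduct)
open import Data.List.Membership.Propositional using (_∈_)
open import Data.List.Membership.Propositional.Properties
  using (∈-filter⁺; ∈-filter⁻; ∈-cartesianProduct⁺; ∈-allFin; ∈-lookup)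
open import Data.List.Membership.Setoid.Properties using (index-injective)
import Data.List.Relation.Unary.All as All
open import Data.List.Relation.Unary.AllPairs using (_∷_)
open import Data.List.Relation.Unary.Any using (index)
open import Data.List.Relation.Unary.Unique.Propositional using (Unique)
open import Data.List.Relation.Unary.Unique.Propositional.Properties
  using (filter⁺; cartesianProduct⁺; allFin⁺)
open import Data.Nat as ℕ using (ℕ; suc; _+_; _≥_; s≤s; z≤n)
open import Data.Nat.Induction using (<-wellFounded)
open import Data.Nat.Properties as ℕ using (≤-refl; ≤-trans; ≤-antisym)
open import Data.Product using (Σ; ∃; proj₁; proj₂)
open import Data.Product.Properties using (,-injective)
open import Data.Sum using (_⊎_; inj₁; inj₂; [_,_]′)
open import Data.Sum.Properties using (inj₁-injective; inj₂-injective)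
open import Data.Vec.Functional using () renaming (_∷_ to _◂_)
open import Function using (_∘_; Injective)
open import Function.Bundles using (Inverse; Equivalence; Injection; mk⇔)
open import Function.Properties.Inverse using (↔⇒↣; ↔-sym)
open import Induction.WellFounded using (Acc; acc)
open import Relation.Binary.Bundles using (Setoid)
open import Relation.Binary.Core using (_Preserves_⟶_)
open import Relation.Binary.Definitions using (tri<; tri≈; tri>)
open import Relation.Binary.PropositionalEquality
  using (_≡_; _≢_; _≗_; refl; sym; trans; cong; cong₂; subst; subst₂; setoid)
open import Relation.Nullary using (¬_; Dec; yes; no; contradiction)
open import Relation.Nullary.Decidable using (_×-dec_; _⊎-dec_; ¬?)
open import Relation.Unary using (Decidable)

private
  variable
    a ℓ : Level
    A : Set a
    m n N : ℕ

-- Increasing maps, enumeration of subsets, and codes for functions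

increasing⇒injective : {f : Fin m → Fin n} → f Preserves _<_ ⟶ _<_ → Injective _≡_ _≡_ f
increasing⇒injective mono {i} {j} fi≡fj with <-cmp i j
... | tri< i<j _ _ = contradiction (mono i<j) (Fin.<-irrefl fi≡fj)
... | tri≈ _ i≡j _ = i≡j
... | tri> _ _ j<i = contradiction (mono j<i) (Fin.<-irrefl (sym fi≡fj))

-- Serves twice: to list the clean positions in a window, and to list the codes that occur when a
-- setoid is counted.
enumerate : {P : Pred (Fin n) ℓ} → Decidable P →
  ∃ λ c → Σ (Fin c → Fin n) λ f →
    f Preserves _<_ ⟶ _<_ × (∀ j → P (f j)) × (∀ i → P i → ∃ λ j → f j ≡ i)
enumerate {n = 0} P? = 0 , (λ ()) , (λ {}) , (λ ()) , λ ()
enumerate {n = suc n} {P = P} P? with enumerate (P? ∘ suc) | P? zero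
... | c , f , mono , sound , complete | yes p₀ = suc c , zero ◂ suc ∘ f , mono′ , sound′ , complete′
  where
  mono′ : (zero ◂ suc ∘ f) Preserves _<_ ⟶ _<_
  mono′ {zero} {suc j} _ = s≤s z≤n
  mono′ {suc i} {suc j} (s≤s i<j) = s≤s (mono i<j)
  sound′ : ∀ j → P ((zero ◂ suc ∘ f) j)
  sound′ zero = p₀
  sound′ (suc j) = sound j
  complete′ : ∀ i → P i → ∃ λ j → (zero ◂ suc ∘ f) j ≡ i
  complete′ zero _ = zero , refl
  complete′ (suc i) p with j , eq ← complete i p = suc j , cong suc eq
... | c , f , mono , sound , complete | no ¬p₀ = c , suc ∘ f , s≤s ∘ mono , sound , complete′
  where
  complete′ : ∀ i → P i → ∃ λ j → suc (f j) ≡ i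
  complete′ zero p = contradiction p ¬p₀
  complete′ (suc i) p with j , eq ← complete i p = j , cong suc eq

lookup-injective : {xs : List A} → Unique xs → Injective _≡_ _≡_ (lookup xs)
lookup-injective (_ ∷ _) {zero} {zero} _ = refl
lookup-injective (x∉ ∷ _) {zero} {suc j} eq = contradiction eq (All.lookup x∉ (∈-lookup j))
lookup-injective (x∉ ∷ _) {suc i} {zero} eq = contradiction (sym eq) (All.lookup x∉ (∈-lookup i))
lookup-injective (_ ∷ uniq) {suc i} {suc j} eq = cong suc (lookup-injective uniq eq)

funToFin-cong : {f g : Fin m → Fin n} → f ≗ g → funToFin f ≡ funToFin g
funToFin-cong {0} _ = refl
funToFin-cong {suc m} f≗g = cong₂ combine (f≗g zero) (funToFin-cong (f≗g ∘ suc))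

funToFin-injective : {f g : Fin m → Fin n} → funToFin f ≡ funToFin g → f ≗ g
funToFin-injective {f = f} {g} eq i =
  trans (sym (finToFun-funToFin f i)) (trans (cong (λ h → finToFun h i) eq) (finToFun-funToFin g i))

⟨$⟩ʳ-injective : (π : Permutation′ n) → Injective _≡_ _≡_ (π ⟨$⟩ʳ_)
⟨$⟩ʳ-injective π = Injection.injective (↔⇒↣ π)

-- Inversions

Inversion : Permutation′ n → Fin n → Fin n → Set
Inversion π i j = i < j × (π ⟨$⟩ʳ j) < (π ⟨$⟩ʳ i)

inversion? : (π : Permutation′ n) → ∀ i j → Dec (Inversion π i j)
inversion? π i j = (i <? j) ×-dec ((π ⟨$⟩ʳ j) <? (π ⟨$⟩ʳ i))

inversions : Permutation′ n → List (Fin n × Fin n)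
inversions {n} π = filter (λ (i , j) → inversion? π i j) (cartesianProduct (allFin n) (allFin n))

nth : (π : Permutation′ n) → Fin (inv π) → Fin n × Fin n
nth π = lookup (inversions π)

nth-inversion : (π : Permutation′ n) → ∀ l → Inversion π (proj₁ (nth π l)) (proj₂ (nth π l))
nth-inversion π l =
  proj₂ (∈-filter⁻ (λ (i , j) → inversion? π i j) {xs = cartesianProduct (allFin _) (allFin _)}
    (∈-lookup {xs = inversions π} l))

nth-injective : (π : Permutation′ n) → Injective _≡_ _≡_ (nth π)
nth-injective {n} π =
  lookup-injective (filter⁺ _ (cartesianProduct⁺ (allFin⁺ n) (allFin⁺ n)))

inversion-∈ : (π : Permutation′ n) → ∀ {i j} → Inversion π i j → (i , j) ∈ inversions π
inversion-∈ π ij = ∈-filter⁺ _ (∈-cartesianProduct⁺ (∈-allFin _) (∈-allFin _)) ij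

rank : (π : Permutation′ n) → ∀ {i j} → Inversion π i j → Fin (inv π)
rank π ij = index (inversion-∈ π ij)

rank-injective : (π : Permutation′ n) → ∀ {i j k l} (ij : Inversion π i j) (kl : Inversion π k l) →
  rank π ij ≡ rank π kl → i ≡ k × j ≡ l
rank-injective π ij kl eq =
  ,-injective (index-injective (setoid _) (inversion-∈ π ij) (inversion-∈ π kl) eq)

-- Sending each inversion of `p` to the rank of its related inversion in `π` is injective. A
-- relation `R` replaces a map on positions so that the partial inverse of `punchIn i` is covered
-- too.
inv-≤ : (p : Permutation′ m) (π : Permutation′ n) (R : Fin m → Fin n → Set) →
  (∀ {i j u} → R i u → R j u → i ≡ j) →
  (∀ {i j} → Inversion p i j → ∃₂ λ u v → Inversion π u v × R i u × R j v) →
  inv p ≤ inv π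
inv-≤ p π R R-injective transfer = injective⇒≤ {f = f} f-injective
  where
  image : ∀ l → ∃₂ λ u v → Inversion π u v × R (proj₁ (nth p l)) u × R (proj₂ (nth p l)) v
  image l = transfer (nth-inversion p l)
  f : Fin (inv p) → Fin (inv π)
  f l = let _ , _ , uv , _ = image l in rank π uv
  f-injective : Injective _≡_ _≡_ f
  f-injective {k} {l} eq with image k | image l
  ... | _ , _ , uv , r₁ , r₂ | _ , _ , uv′ , s₁ , s₂ with rank-injective π uv uv′ eq
  ... | refl , refl = nth-injective p (cong₂ _,_ (R-injective r₁ s₁) (R-injective r₂ s₂))

inv≤1⇒unique : (p : Permutation′ n) → inv p ≤ 1 → ∀ {i j k l} →
  Inversion p i j → Inversion p k l → i ≡ k × j ≡ l
inv≤1⇒unique p inv≤1 ij kl = rank-injective p ij kl (at-most-one inv≤1 _ _)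
  where
  at-most-one : ∀ {c} → c ≤ 1 → (x y : Fin c) → x ≡ y
  at-most-one (s≤s z≤n) zero zero = refl

contains⇒inv≤ : (π : Permutation′ n) (p : Permutation′ m) → Contains π p → inv p ≤ inv π
contains⇒inv≤ π p (f , mono , iff) =
  inv-≤ p π (λ i u → u ≡ f i) (λ r s → increasing⇒injective mono (trans (sym r) s))
    (λ (i<j , pj<pi) → _ , _ , (mono i<j , Equivalence.to (iff _ _) pj<pi) , refl , refl)

contains-trans : (π : Permutation′ N) (ρ : Permutation′ n) (p : Permutation′ m) →
  Contains π ρ → Contains ρ p → Contains π p
contains-trans π ρ p (f , f-mono , f-iff) (g , g-mono , g-iff) =
  f ∘ g , f-mono ∘ g-mono , λ i j →
    mk⇔ (Equivalence.to (f-iff _ _) ∘ Equivalence.to (g-iff i j))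
        (Equivalence.from (g-iff i j) ∘ Equivalence.from (f-iff _ _))

-- Distinct positions carry distinct values, so the relative order of two values is settled by
-- whether the two positions form an inversion.
inversions⇒contains : (π : Permutation′ n) (p : Permutation′ m) (f : Fin m → Fin n) →
  f Preserves _<_ ⟶ _<_ →
  (∀ {i j} → Inversion p i j → Inversion π (f i) (f j)) →
  (∀ {i j} → i < j → Inversion π (f i) (f j) → Inversion p i j) →
  Contains π p
inversions⇒contains π p f mono to from = f , mono , λ i j → mk⇔ (forward i j) (backward i j)
  where
  forward : ∀ i j → (p ⟨$⟩ʳ i) < (p ⟨$⟩ʳ j) → (π ⟨$⟩ʳ f i) < (π ⟨$⟩ʳ f j)
  forward i j pi<pj with <-cmp i j
  ... | tri≈ _ refl _ = contradiction pi<pj (Fin.<-irrefl refl)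
  ... | tri> _ _ j<i = proj₂ (to (j<i , pi<pj))
  ... | tri< i<j i≢j _ with <-cmp (π ⟨$⟩ʳ f i) (π ⟨$⟩ʳ f j)
  ...   | tri< lt _ _ = lt
  ...   | tri≈ _ eq _ = contradiction (increasing⇒injective mono (⟨$⟩ʳ-injective π eq)) i≢j
  ...   | tri> _ _ gt = contradiction (proj₂ (from i<j (mono i<j , gt))) (Fin.<-asym pi<pj)
  backward : ∀ i j → (π ⟨$⟩ʳ f i) < (π ⟨$⟩ʳ f j) → (p ⟨$⟩ʳ i) < (p ⟨$⟩ʳ j)
  backward i j lt with <-cmp i j
  ... | tri≈ _ refl _ = contradiction lt (Fin.<-irrefl refl)
  ... | tri> _ _ j<i = proj₂ (from j<i (mono j<i , lt))
  ... | tri< i<j i≢j _ with <-cmp (p ⟨$⟩ʳ i) (p ⟨$⟩ʳ j)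
  ...   | tri< pi<pj _ _ = pi<pj
  ...   | tri≈ _ eq _ = contradiction (⟨$⟩ʳ-injective p eq) i≢j
  ...   | tri> _ _ pj<pi = contradiction (proj₂ (to (i<j , pj<pi))) (Fin.<-asym lt)

-- Positions that take part in no inversion

Involved : Permutation′ n → Pred (Fin n) 0ℓ
Involved π i = ∃ λ j → Inversion π i j ⊎ Inversion π j i

involved? : (π : Permutation′ n) → Decidable (Involved π)
involved? π i = any? λ j → inversion? π i j ⊎-dec inversion? π j i

Clean : Permutation′ n → Pred (Fin n) 0ℓ
Clean π i = ¬ Involved π i

clean-mono : (π : Permutation′ n) → ∀ {i j} → Clean π i ⊎ Clean π j → i < j → (π ⟨$⟩ʳ i) < (π ⟨$⟩ʳ j)
clean-mono π {i} {j} clean i<j with <-cmp (π ⟨$⟩ʳ i) (π ⟨$⟩ʳ j)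
... | tri< lt _ _ = lt
... | tri≈ _ eq _ = contradiction i<j (Fin.<-irrefl (⟨$⟩ʳ-injective π eq))
... | tri> _ _ gt =
  ⊥-elim ([ (λ c → c (j , inj₁ (i<j , gt))) , (λ c → c (i , inj₂ (i<j , gt))) ]′ clean)

-- A clean `z` strictly between `x` and `y` would force the values to increase from `x` to `z` and
-- from `z` to `y`, contradicting the inversion.
clean-outside : (π : Permutation′ n) → ∀ {x y z} → Inversion π x y → Clean π z → z < x ⊎ y < z
clean-outside π {x} {y} {z} xy@(_ , πy<πx) clean with <-cmp z x | <-cmp z y
... | tri< z<x _ _ | _ = inj₁ z<x
... | tri≈ _ refl _ | _ = contradiction (y , inj₁ xy) clean
... | tri> _ _ _ | tri≈ _ refl _ = contradiction (x , inj₂ xy) clean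
... | tri> _ _ _ | tri> _ _ y<z = inj₂ y<z
... | tri> _ _ x<z | tri< z<y _ _ = contradiction πy<πx
  (Fin.<-asym (Fin.<-trans (clean-mono π (inj₂ clean) x<z) (clean-mono π (inj₁ clean) z<y)))

twice : ℕ → ℕ
twice k = k + k

-- An involved position is recovered from one of its inversions and the side on which it occurs there.
involvedCode : (π : Permutation′ n) → ∀ {i} → Involved π i → Fin (inv π) ⊎ Fin (inv π)
involvedCode π (_ , inj₁ ij) = inj₁ (rank π ij)
involvedCode π (_ , inj₂ ji) = inj₂ (rank π ji)

involvedCode-injective : (π : Permutation′ n) → ∀ {i j} (x : Involved π i) (y : Involved π j) →
  involvedCode π x ≡ involvedCode π y → i ≡ j
involvedCode-injective π (_ , inj₁ x) (_ , inj₁ y) eq = proj₁ (rank-injective π x y (inj₁-injective eq))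
involvedCode-injective π (_ , inj₂ x) (_ , inj₂ y) eq = proj₂ (rank-injective π x y (inj₂-injective eq))

⊎-injective⇒≤ : ∀ {c d} {f : Fin n → Fin c ⊎ Fin d} → Injective _≡_ _≡_ f → n ≤ c + d
⊎-injective⇒≤ f-injective =
  injective⇒≤ (f-injective ∘ Injection.injective (↔⇒↣ (↔-sym Fin.+↔⊎)))

-- Each position of the window `e` is coded injectively: a clean one by its index in the list `f`,
-- an involved one by an inversion and a side.
clean-bound : (π : Permutation′ N) (e : Fin m → Fin N) → Injective _≡_ _≡_ e →
  ∀ {c} (f : Fin c → Fin m) → (∀ i → Clean π (e i) → ∃ λ j → f j ≡ i) →
  m ≤ c + twice (inv π)
clean-bound π e e-injective {c} f complete =
  ⊎-injective⇒≤ {f = λ i → code i (involved? π (e i))} (code-injective _ _)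
  where
  code : ∀ i → Dec (Involved π (e i)) → Fin c ⊎ Fin (twice (inv π))
  code i (yes involved) = inj₂ (Inverse.from Fin.+↔⊎ (involvedCode π involved))
  code i (no clean) = inj₁ (proj₁ (complete i clean))
  code-injective : ∀ {i j} x y → code i x ≡ code j y → i ≡ j
  code-injective (yes x) (yes y) eq = e-injective (involvedCode-injective π x y
    (Injection.injective (↔⇒↣ (↔-sym Fin.+↔⊎)) (inj₂-injective eq)))
  code-injective (no x) (no y) eq = trans (sym (proj₂ (complete _ x)))
    (trans (cong f (inj₁-injective eq)) (proj₂ (complete _ y)))

-- Runs of clean positions

record CleanRun (π : Permutation′ N) (m start end : ℕ) : Set where
  field
    at : Fin m → Fin N
    increasing : at Preserves _<_ ⟶ _<_
    clean : ∀ j → Clean π (at j)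
    start≤ : ∀ j → start ≤ toℕ (at j)
    <end : ∀ j → toℕ (at j) ℕ.< end

cleanPositions : (π : Permutation′ N) → ∀ s m → s + (m + twice (inv π)) ≤ N →
  CleanRun π m s (s + (m + twice (inv π)))
cleanPositions {N} π s m fits =
  let c , f , f-mono , f-clean , f-complete = enumerate (¬? ∘ involved? π ∘ e)
      m≤c = ℕ.+-cancelʳ-≤ (twice (inv π)) m c
              (clean-bound π e (increasing⇒injective e-mono) f f-complete)
      -- The window has length `m + twice (inv π)`, so it holds c ≥ m clean positions; the first `m`
      -- are kept.
      g = λ j → f (inject≤ j m≤c)
  in record
    { at = e ∘ g
    ; increasing = λ {i} {j} i<j → e-mono (f-mono
        (subst₂ ℕ._<_ (sym (toℕ-inject≤ i m≤c)) (sym (toℕ-inject≤ j m≤c)) i<j))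
    ; clean = λ j → f-clean (inject≤ j m≤c)
    ; start≤ = λ j → subst (s ≤_) (sym (toℕ-e (g j))) (ℕ.m≤m+n s _)
    ; <end = λ j → subst (ℕ._< s + (m + twice (inv π))) (sym (toℕ-e (g j)))
        (ℕ.+-monoʳ-< s (toℕ<n (g j)))
    }
  where
  e : Fin (m + twice (inv π)) → Fin N
  e j = fromℕ< (ℕ.<-≤-trans (ℕ.+-monoʳ-< s (toℕ<n j)) fits)
  toℕ-e : ∀ j → toℕ (e j) ≡ s + toℕ j
  toℕ-e j = toℕ-fromℕ< _
  e-mono : e Preserves _<_ ⟶ _<_
  e-mono {i} {j} i<j = subst₂ ℕ._<_ (sym (toℕ-e i)) (sym (toℕ-e j)) (ℕ.+-monoʳ-< s i<j)

-- Embedding a pattern with at most one inversion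

data Placed (u v : Fin m) (lo hi : Fin m → Fin N) (x y : Fin N) : Fin m → Fin N → Set where
  below : ∀ {j} → j < u → Placed u v lo hi x y j (lo j)
  left  : Placed u v lo hi x y u x
  right : Placed u v lo hi x y v y
  above : ∀ {j} → v < j → Placed u v lo hi x y j (hi j)

-- A position `j` in between would give a second inversion: with `u` if its value is below that of
-- `u`, and with `v` otherwise. Hence `Placed` needs no case between `u` and `v`.
inversion-adjacent : (p : Permutation′ n) → inv p ≤ 1 → ∀ {u v} → Inversion p u v →
  ∀ {j} → u < j → ¬ j < v
inversion-adjacent p inv≤1 {u} {v} uv@(_ , pv<pu) {j} u<j j<v with (p ⟨$⟩ʳ j) <? (p ⟨$⟩ʳ u)
... | yes pj<pu = Fin.<-irrefl (proj₂ (inv≤1⇒unique p inv≤1 (u<j , pj<pu) uv)) j<v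
... | no pj≮pu = Fin.<-irrefl (sym (proj₁ (inv≤1⇒unique p inv≤1 (j<v , pv<pj) uv))) u<j
  where
  pv<pj : (p ⟨$⟩ʳ v) < (p ⟨$⟩ʳ j)
  pv<pj = ℕ.<-≤-trans pv<pu (ℕ.≮⇒≥ pj≮pu)

-- The inversion of `p` goes to `x` and `y`, and all other positions of `p` go to clean positions,
-- which create no further inversion. Both `lo` and `hi` have full length `m`, so a position of `p`
-- serves as its own index on either side.
inversion-between-cleans⇒contains :
  (π : Permutation′ N) (p : Permutation′ m) → inv p ≤ 1 → ∀ {x y} → Inversion π x y →
  (lo hi : Fin m → Fin N) → lo Preserves _<_ ⟶ _<_ → hi Preserves _<_ ⟶ _<_ →
  (∀ j → Clean π (lo j)) → (∀ j → Clean π (hi j)) → (∀ j → lo j < x) → (∀ j → y < hi j) →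
  Contains π p
inversion-between-cleans⇒contains {N} {m} π p inv≤1 {x} {y} xy@(x<y , _)
  lo hi lo-mono hi-mono lo-clean hi-clean lo<x y<hi
  with any? (λ u → any? (λ v → inversion? p u v))
-- Without inversions `p` is increasing, and the clean positions `lo` alone form an occurrence of
-- it.
... | no none = inversions⇒contains π p lo lo-mono
  (λ ij → contradiction (_ , _ , ij) none)
  (λ _ ij → contradiction (_ , inj₁ ij) (lo-clean _))
... | yes (u , v , uv@(u<v , _)) = inversions⇒contains π p (proj₁ ∘ place)
  (λ {i} {j} → placed-mono (proj₂ (place i)) (proj₂ (place j)))
  to
  (λ {i} {j} → from (proj₂ (place i)) (proj₂ (place j)))
  where
  P : Fin m → Fin N → Set
  P = Placed u v lo hi x y

  place : ∀ j → ∃ (P j)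
  place j with <-cmp j u | <-cmp j v
  ... | tri< j<u _ _ | _ = _ , below j<u
  ... | tri≈ _ refl _ | _ = _ , left
  ... | tri> _ _ u<j | tri< j<v _ _ = contradiction j<v (inversion-adjacent p inv≤1 uv u<j)
  ... | tri> _ _ _ | tri≈ _ refl _ = _ , right
  ... | tri> _ _ _ | tri> _ _ v<j = _ , above v<j

  lo<hi : ∀ i j → lo i < hi j
  lo<hi i j = Fin.<-trans (lo<x i) (Fin.<-trans x<y (y<hi j))

  placed-mono : ∀ {i j a b} → P i a → P j b → i < j → a < b
  placed-mono (below _) (below _) i<j = lo-mono i<j
  placed-mono (below _) left _ = lo<x _
  placed-mono (below _) right _ = Fin.<-trans (lo<x _) x<y
  placed-mono (below _) (above _) _ = lo<hi _ _
  placed-mono left (below j<u) u<j = contradiction j<u (Fin.<-asym u<j)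
  placed-mono left left u<u = contradiction u<u (Fin.<-irrefl refl)
  placed-mono left right _ = x<y
  placed-mono left (above _) _ = Fin.<-trans x<y (y<hi _)
  placed-mono right (below j<u) v<j = contradiction (Fin.<-trans v<j j<u) (Fin.<-asym u<v)
  placed-mono right left v<u = contradiction v<u (Fin.<-asym u<v)
  placed-mono right right v<v = contradiction v<v (Fin.<-irrefl refl)
  placed-mono right (above _) _ = y<hi _
  placed-mono (above v<i) (below j<u) i<j =
    contradiction (Fin.<-trans v<i (Fin.<-trans i<j j<u)) (Fin.<-asym u<v)
  placed-mono (above v<i) left i<u = contradiction (Fin.<-trans v<i i<u) (Fin.<-asym u<v)
  placed-mono (above v<i) right i<v = contradiction i<v (Fin.<-asym v<i)
  placed-mono (above _) (above _) i<j = hi-mono i<j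

  -- `place u` is stuck on its comparisons, so its value is read off from the constructors of
  -- `Placed` instead.
  placed-u : ∀ {a} → P u a → a ≡ x
  placed-u (below u<u) = contradiction u<u (Fin.<-irrefl refl)
  placed-u left = refl
  placed-u right = contradiction u<v (Fin.<-irrefl refl)
  placed-u (above v<u) = contradiction v<u (Fin.<-asym u<v)

  placed-v : ∀ {a} → P v a → a ≡ y
  placed-v (below v<u) = contradiction v<u (Fin.<-asym u<v)
  placed-v left = contradiction u<v (Fin.<-irrefl refl)
  placed-v right = refl
  placed-v (above v<v) = contradiction v<v (Fin.<-irrefl refl)

  to : ∀ {i j} → Inversion p i j → Inversion π (proj₁ (place i)) (proj₁ (place j))
  to ij with inv≤1⇒unique p inv≤1 ij uv
  ... | refl , refl =
    subst₂ (Inversion π) (sym (placed-u (proj₂ (place u)))) (sym (placed-v (proj₂ (place v)))) xy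

  from : ∀ {i j a b} → P i a → P j b → i < j → Inversion π a b → Inversion p i j
  -- Every other pair has a clean member or is not in increasing order.
  from left right _ _ = uv
  from (below _) _ _ ab = contradiction (_ , inj₁ ab) (lo-clean _)
  from (above _) _ _ ab = contradiction (_ , inj₁ ab) (hi-clean _)
  from _ (below _) _ ab = contradiction (_ , inj₂ ab) (lo-clean _)
  from _ (above _) _ ab = contradiction (_ , inj₂ ab) (hi-clean _)
  from left left u<u _ = contradiction u<u (Fin.<-irrefl refl)
  from right left v<u _ = contradiction v<u (Fin.<-asym u<v)
  from right right v<v _ = contradiction v<v (Fin.<-irrefl refl)

-- If an inversion had `i` as an endpoint, `clean-outside` would push the run before `i` to its left
-- and the run after `i` to its right, and `p` would be contained in `π`.
clean-between-runs : (π : Permutation′ N) (p : Permutation′ m) → inv p ≤ 1 → ¬ Contains π p →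
  ∀ i {start end} → CleanRun π m start (toℕ i) → CleanRun π m (suc (toℕ i)) end → Clean π i
clean-between-runs π p inv≤1 avoids i lo hi = clean
  where
  module Lo = CleanRun lo
  module Hi = CleanRun hi
  not-straddled : ∀ {x y} → Inversion π x y → toℕ x ≤ toℕ i → ¬ (toℕ i ≤ toℕ y)
  not-straddled {x} {y} xy x≤i i≤y = avoids (inversion-between-cleans⇒contains π p inv≤1 xy
    Lo.at Hi.at Lo.increasing Hi.increasing Lo.clean Hi.clean lo<x y<hi)
    where
    lo<x : ∀ j → Lo.at j < x
    lo<x j with clean-outside π xy (Lo.clean j)
    ... | inj₁ lt = lt
    ... | inj₂ y<lo = contradiction (ℕ.<-trans y<lo (Lo.<end j)) (ℕ.≤⇒≯ i≤y)
    y<hi : ∀ j → y < Hi.at j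
    y<hi j with clean-outside π xy (Hi.clean j)
    ... | inj₁ hi<x = contradiction (ℕ.<-trans (Hi.start≤ j) hi<x) (ℕ.≤⇒≯ x≤i)
    ... | inj₂ lt = lt
  clean : Clean π i
  clean (_ , inj₁ ij@(i<j , _)) = not-straddled ij ≤-refl (ℕ.<⇒≤ i<j)
  clean (_ , inj₂ ji@(j<i , _)) = not-straddled ji (ℕ.<⇒≤ j<i) ≤-refl

middle-clean : (π : Permutation′ N) (p : Permutation′ m) → inv p ≤ 1 → ¬ Contains π p →
  ∀ i → toℕ i ≡ m + twice (inv π) → suc (toℕ i) + (m + twice (inv π)) ≤ N → Clean π i
middle-clean {N} {m} π p inv≤1 avoids i i≡ fits = clean-between-runs π p inv≤1 avoids i
  (subst (CleanRun π m 0) (sym i≡) (cleanPositions π 0 m (subst (_≤ N) i≡ (ℕ.<⇒≤ (toℕ<n i)))))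
  (cleanPositions π (suc (toℕ i)) m fits)

-- Removing a clean position

-- The positions before `i` carry distinct values below that of `i`. Only monotonicity before `i` is
-- assumed, so that the lemma also applies to the inverse permutation.
clean⇒≤ : (π : Permutation′ n) → ∀ i → (∀ {j} → j < i → (π ⟨$⟩ʳ j) < (π ⟨$⟩ʳ i)) →
  toℕ i ≤ toℕ (π ⟨$⟩ʳ i)
clean⇒≤ π i mono = injective⇒≤ {f = f} f-injective
  where
  π-inject< : ∀ j → (π ⟨$⟩ʳ inject j) < (π ⟨$⟩ʳ i)
  π-inject< j = mono (subst (ℕ._< toℕ i) (sym (toℕ-inject j)) (toℕ<n j))
  f : Fin (toℕ i) → Fin (toℕ (π ⟨$⟩ʳ i))
  f j = fromℕ< (π-inject< j)
  f-injective : Injective _≡_ _≡_ f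
  f-injective {j} {k} eq = toℕ-injective
    (trans (sym (toℕ-inject j)) (trans (cong toℕ inject≡) (toℕ-inject k)))
    where
    inject≡ : inject j ≡ inject k
    inject≡ = ⟨$⟩ʳ-injective π (toℕ-injective (Fin.fromℕ<-injective _ _ _ _ eq))

-- One inequality is `clean⇒≤` for `π`, the other is `clean⇒≤` for `flip π`: values smaller than
-- that of a clean `i` sit before `i`.
clean⇒fixed : (π : Permutation′ n) → ∀ {i} → Clean π i → (π ⟨$⟩ʳ i) ≡ i
clean⇒fixed π {i} clean = toℕ-injective (≤-antisym πi≤i (clean⇒≤ π i (clean-mono π (inj₂ clean))))
  where
  flip-mono : ∀ {j} → j < (π ⟨$⟩ʳ i) → (π ⟨$⟩ˡ j) < (flip π ⟨$⟩ʳ (π ⟨$⟩ʳ i))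
  flip-mono {j} j<πi = subst ((π ⟨$⟩ˡ j) <_) (sym (inverseˡ π)) π⁻¹j<i
    where
    ππ⁻¹j<πi : (π ⟨$⟩ʳ (π ⟨$⟩ˡ j)) < (π ⟨$⟩ʳ i)
    ππ⁻¹j<πi = subst (_< (π ⟨$⟩ʳ i)) (sym (inverseʳ π)) j<πi
    π⁻¹j<i : (π ⟨$⟩ˡ j) < i
    π⁻¹j<i with <-cmp (π ⟨$⟩ˡ j) i
    ... | tri< lt _ _ = lt
    ... | tri≈ _ eq _ = contradiction ππ⁻¹j<πi (Fin.<-irrefl (cong (π ⟨$⟩ʳ_) eq))
    ... | tri> _ _ gt = contradiction ππ⁻¹j<πi (Fin.<-asym (clean-mono π (inj₁ clean) gt))
  πi≤i : toℕ (π ⟨$⟩ʳ i) ≤ toℕ i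
  πi≤i = subst (λ j → toℕ (π ⟨$⟩ʳ i) ≤ toℕ j) (inverseˡ π) (clean⇒≤ (flip π) (π ⟨$⟩ʳ i) flip-mono)

punchIn-mono-< : ∀ i {j k : Fin n} → j < k → punchIn i j < punchIn i k
punchIn-mono-< i j<k = ℕ.≰⇒> (λ le → ℕ.<⇒≱ j<k (punchIn-cancel-≤ i _ _ le))

punchIn-cancel-< : ∀ i {j k : Fin n} → punchIn i j < punchIn i k → j < k
punchIn-cancel-< i lt = ℕ.≰⇒> (λ le → ℕ.<⇒≱ lt (punchIn-mono-≤ i _ _ le))

contains-remove : (π : Permutation′ (suc n)) → ∀ i → Contains π (remove i π)
contains-remove π i = punchIn i , punchIn-mono-< i , λ j k → mk⇔
  (subst₂ _<_ (sym (punchIn-permute π i j)) (sym (punchIn-permute π i k)) ∘ punchIn-mono-< (π ⟨$⟩ʳ i))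
  (punchIn-cancel-< (π ⟨$⟩ʳ i) ∘ subst₂ _<_ (punchIn-permute π i j) (punchIn-permute π i k))

punchIn-surjective : ∀ {i j : Fin (suc n)} → i ≢ j → ∃ λ k → punchIn i k ≡ j
punchIn-surjective i≢j = punchOut i≢j , punchIn-punchOut i≢j

-- Removal cannot add inversions, by containment. None is lost, because both ends of every inversion
-- differ from the clean `i` and so lie in the image of `punchIn i`.
inv-remove : (π : Permutation′ (suc n)) → ∀ {i} → Clean π i → inv (remove i π) ≡ inv π
inv-remove π {i} clean = ≤-antisym
  (contains⇒inv≤ π (remove i π) (contains-remove π i))
  (inv-≤ π (remove i π) (λ j u → punchIn i u ≡ j) (λ r s → trans (sym r) s) transfer)
  where
  transfer : ∀ {j k} → Inversion π j k →
    ∃₂ λ u v → Inversion (remove i π) u v × punchIn i u ≡ j × punchIn i v ≡ k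
  transfer {j} {k} jk@(j<k , πk<πj)
    with punchIn-surjective (λ i≡j → clean (k , inj₁ (subst (λ l → Inversion π l k) (sym i≡j) jk)))
       | punchIn-surjective (λ i≡k → clean (j , inj₂ (subst (Inversion π j) (sym i≡k) jk)))
  ... | u , refl | v , refl = u , v ,
    (punchIn-cancel-< i j<k ,
     punchIn-cancel-< (π ⟨$⟩ʳ i) (subst₂ _<_ (punchIn-permute π i v) (punchIn-permute π i u) πk<πj)) ,
    refl , refl

-- Both permutations delete the same value `i` at the same position `i`, so the same `punchIn`
-- restores the remaining values.
remove-injective : (π ρ : Permutation′ (suc n)) → ∀ i → (π ⟨$⟩ʳ i) ≡ i → (ρ ⟨$⟩ʳ i) ≡ i →
  (remove i π ⟨$⟩ʳ_) ≗ (remove i ρ ⟨$⟩ʳ_) → (π ⟨$⟩ʳ_) ≗ (ρ ⟨$⟩ʳ_)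
remove-injective π ρ i πi ρi same j with i ≟ j
... | yes refl = trans πi (sym ρi)
... | no i≢j with k , refl ← punchIn-surjective i≢j =
  trans (punchIn-permute π i k)
    (trans (cong₂ punchIn (trans πi (sym ρi)) (same k)) (sym (punchIn-permute ρ i k)))

-- Counting

-- The map `f` codes equivalence classes faithfully. Excluded middle decides which codes occur, and
-- their number is the cardinality.
finite-setoid : ExcludedMiddle ℓ → (S : Setoid ℓ 0ℓ) → let open Setoid S in
  (f : Carrier → Fin n) → (∀ {x y} → x ≈ y → f x ≡ f y) → (∀ {x y} → f x ≡ f y → x ≈ y) →
  ∃ λ c → Inverse (setoid (Fin c)) S
finite-setoid {n = n} em S f f-cong f-injective
  with enumerate {n = n} {P = λ j → ∃ λ x → f x ≡ j} (λ _ → em)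
... | c , e , e-mono , preimage , complete = c , record
  { to = λ j → proj₁ (preimage j)
  ; from = λ x → proj₁ (complete (f x) (x , refl))
  ; to-cong = λ { refl → Setoid.refl S }
  ; from-cong = λ {x} {y} x≈y → increasing⇒injective e-mono
      (trans (e-from x) (trans (f-cong x≈y) (sym (e-from y))))
  ; inverse =
      (λ { {x} refl → f-injective (trans (proj₂ (preimage _)) (e-from x)) }) ,
      (λ {j} {x} x≈to → increasing⇒injective e-mono
        (trans (e-from x) (trans (f-cong x≈to) (proj₂ (preimage j)))))
  }
  where
  e-from : ∀ x → e (proj₁ (complete (f x) (x , refl))) ≡ f x
  e-from x = proj₂ (complete (f x) (x , refl))

avCount : ExcludedMiddle ℓ → (B : Pred Pattern ℓ) → ∀ n k → ∃ (AvCount B n k)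
-- The code is the one-line notation, read as a number below n^n.
avCount em B n k = finite-setoid em (AvSetoid B n k) (λ x → funToFin (proj₁ x ⟨$⟩ʳ_))
  funToFin-cong funToFin-injective

from-injective : ∀ {c} (S : Setoid ℓ 0ℓ) (i : Inverse (setoid (Fin c)) S) →
  ∀ {x y} → Inverse.from i x ≡ Inverse.from i y → Setoid._≈_ S x y
from-injective S i eq =
  Setoid.trans S (Setoid.sym S (Inverse.strictlyInverseˡ i _)) (Inverse.inverseˡ i eq)

to-injective : ∀ {c} (S : Setoid ℓ 0ℓ) (i : Inverse (setoid (Fin c)) S) →
  ∀ {x y} → Setoid._≈_ S (Inverse.to i x) (Inverse.to i y) → x ≡ y
to-injective S i eq = trans (sym (Inverse.strictlyInverseʳ i _)) (Inverse.inverseʳ i eq)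

-- Well-founded descent on the value: restart at a later index with a smaller value if there is one;
-- otherwise the sequence is already constant.
eventually-constant : ExcludedMiddle ℓ → (c : ℕ → ℕ) → ∀ m →
  (∀ n → n ≥ m → c (suc n) ≤ c n) → ∃ λ m′ → ∀ n → n ≥ m′ → c n ≡ c m′
eventually-constant em c m decreasing = go m decreasing (<-wellFounded (c m))
  where
  antitone : ∀ m → (∀ n → n ≥ m → c (suc n) ≤ c n) → ∀ d → c (d + m) ≤ c m
  antitone m dec 0 = ≤-refl
  antitone m dec (suc d) = ≤-trans (dec (d + m) (ℕ.m≤n+m m d)) (antitone m dec d)
  go : ∀ m → (∀ n → n ≥ m → c (suc n) ≤ c n) → Acc ℕ._<_ (c m) →
    ∃ λ m′ → ∀ n → n ≥ m′ → c n ≡ c m′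
  go m dec (acc rec) with em {Lift _ (∃ λ n → n ≥ m × c n ℕ.< c m)}
  ... | yes (lift (n , n≥m , smaller)) = go n (λ l l≥n → dec l (≤-trans n≥m l≥n)) (rec smaller)
  ... | no none = m , λ n n≥m → ≤-antisym
    (subst (λ l → c l ≤ c m) (ℕ.m∸n+n≡m n≥m) (antitone m dec (n ℕ.∸ m)))
    (ℕ.≮⇒≥ (λ smaller → none (lift (n , n≥m , smaller))))

-- From a small pattern to a limit sequence

small-pattern⇒limit : ExcludedMiddle ℓ → (B : Pred Pattern ℓ) →
  (∃₂ λ m p → B (m , p) × inv p ≤ 1) → HasLimitSequence B
small-pattern⇒limit em B (m , p , p∈B , inv≤1) k =
  let m′ , constant = eventually-constant em count (L + L) decreasing
  in m′ , count m′ , λ n n≥m′ → subst (AvCount B n k) (constant n n≥m′) (proj₂ (avCount em B n k))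
  where
  L : ℕ
  -- The pattern `p` has length `suc m`, so a window of length `L` contains a clean run of that
  -- length.
  L = suc m + twice k
  count : ℕ → ℕ
  count n = proj₁ (avCount em B n k)
  decreasing : ∀ n → n ≥ L + L → count (suc n) ≤ count n
  decreasing n n≥ = injective⇒≤ {f = Inverse.from small ∘ delete ∘ Inverse.to big}
    (λ {j} {l} eq → to-injective (AvSetoid B (suc n) k) big
      (delete-injective {Inverse.to big j} {Inverse.to big l}
        (from-injective (AvSetoid B n k) small
          {delete (Inverse.to big j)} {delete (Inverse.to big l)} eq)))
    where
    small = proj₂ (avCount em B n k)
    big = proj₂ (avCount em B (suc n) k)
    open Setoid (AvSetoid B n k) using () renaming (Carrier to Small; _≈_ to _≈ₛ_)
    open Setoid (AvSetoid B (suc n) k) using () renaming (Carrier to Big; _≈_ to _≈ᵦ_)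
    L<suc-n : L ℕ.< suc n
    L<suc-n = s≤s (≤-trans (ℕ.m≤m+n L L) n≥)
    -- Position `L`, counted from 0: exactly `L` positions precede it and, since n ≥ 2L, at least
    -- `L` follow it.
    i : Fin (suc n)
    i = fromℕ< L<suc-n
    clean : (x : Big) → Clean (proj₁ x) i
    clean (π , refl , avoids) = middle-clean π p inv≤1 (avoids m p p∈B) i (toℕ-fromℕ< L<suc-n)
      (subst (λ l → suc l + L ≤ suc n) (sym (toℕ-fromℕ< L<suc-n)) (s≤s n≥))
    delete : Big → Small
    delete x@(π , inv≡k , avoids) = remove i π , trans (inv-remove π (clean x)) inv≡k ,
      λ m q q∈B found → avoids m q q∈B (contains-trans π (remove i π) q (contains-remove π i) found)
    delete-injective : ∀ {x y} → delete x ≈ₛ delete y → x ≈ᵦ y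
    delete-injective {x} {y} = remove-injective (proj₁ x) (proj₁ y) i
      (clean⇒fixed (proj₁ x) (clean x)) (clean⇒fixed (proj₁ y) (clean y))

-- Adjacent transpositions

-- Swaps `inject₁ i` and `suc i`. The recursion makes the values compute, so that inversions are
-- found by matching on positions.
adjacent : Fin n → Permutation′ (suc n)
adjacent {suc n} zero = swap id
adjacent (suc i) = lift₀ (adjacent i)

adjacent-inversion : (i : Fin n) → Inversion (adjacent i) (inject₁ i) (suc i)
adjacent-inversion zero = s≤s z≤n , s≤s z≤n
adjacent-inversion (suc i) with lt , gt ← adjacent-inversion i = s≤s lt , s≤s gt

adjacent-inversion-unique : (i : Fin n) → ∀ {x y} → Inversion (adjacent i) x y →
  x ≡ inject₁ i × y ≡ suc i
adjacent-inversion-unique zero {zero} {suc zero} _ = refl , refl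
adjacent-inversion-unique zero {zero} {suc (suc y)} (_ , s≤s ())
adjacent-inversion-unique zero {suc zero} {suc zero} (s≤s () , _)
adjacent-inversion-unique zero {suc zero} {suc (suc y)} (_ , ())
adjacent-inversion-unique zero {suc (suc x)} {suc (suc y)} (lt , gt) = contradiction lt (Fin.<-asym gt)
adjacent-inversion-unique zero {suc (suc x)} {suc zero} (s≤s () , _)
adjacent-inversion-unique (suc i) {zero} {suc y} (_ , ())
adjacent-inversion-unique (suc i) {suc x} {suc y} (s≤s lt , s≤s gt)
  with refl , refl ← adjacent-inversion-unique i (lt , gt) = refl , refl

inv-adjacent : (i : Fin n) → inv (adjacent i) ≡ 1
inv-adjacent i = ≤-antisym
  (injective⇒≤ {n = 1} {f = λ _ → zero} (λ {k} {l} _ → nth-injective π (trans (nth≡ k) (sym (nth≡ l)))))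
  (ℕ.≤-<-trans z≤n (toℕ<n (rank π (adjacent-inversion i))))
  where
  π = adjacent i
  nth≡ : ∀ k → nth π k ≡ (inject₁ i , suc i)
  nth≡ k with eq₁ , eq₂ ← adjacent-inversion-unique i (nth-inversion π k) = cong₂ _,_ eq₁ eq₂

-- The index is determined by the only inversion, which depends on the values alone.
adjacent-injective : {i j : Fin n} → (adjacent i ⟨$⟩ʳ_) ≗ (adjacent j ⟨$⟩ʳ_) → i ≡ j
adjacent-injective {i = i} {j} same with lt , gt ← adjacent-inversion i =
  Fin.suc-injective (proj₂ (adjacent-inversion-unique j (lt , subst₂ _<_ (same _) (same _) gt)))

-- From a limit sequence to a small pattern

limit⇒small-pattern : ExcludedMiddle ℓ → (B : Pred Pattern ℓ) →
  HasLimitSequence B → ∃₂ λ m p → B (m , p) × inv p ≤ 1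
limit⇒small-pattern em B limit with em {∃₂ λ m p → B (m , p) × inv p ≤ 1} | limit 1
... | yes found | _ = found
... | no none | m , c , count = contradiction
  (injective⇒≤ {f = Inverse.from av ∘ transposition}
    (λ {i} {j} eq → adjacent-injective
      (from-injective (AvSetoid B size 1) av {transposition i} {transposition j} eq)))
  (ℕ.<⇒≱ (ℕ.m≤n+m (suc c) m))
  where
  -- Large enough to be at least `m` and to admit m + c + 1 adjacent transpositions, more than the
  -- supposed count `c`.
  size = suc (m + suc c)
  av = count size (≤-trans (ℕ.m≤m+n m (suc c)) (ℕ.n≤1+n _))
  transposition : Fin (m + suc c) → Setoid.Carrier (AvSetoid B size 1)
  -- A pattern of `B` contained in a transposition would have at most one inversion, against `none`.
  transposition i = adjacent i , inv-adjacent i , λ l q q∈B found →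
    none (l , q , q∈B , subst (inv q ≤_) (inv-adjacent i) (contains⇒inv≤ (adjacent i) q found))

proposition5p1 : ∀ {ℓ} → ExcludedMiddle ℓ → (B : Pred Pattern ℓ) →
    HasLimitSequence B ⇔ (∃₂ λ m p → B (m , p) × inv p ≤ 1)
proposition5p1 em B = mk⇔ (limit⇒small-pattern em B) (small-pattern⇒limit em B)
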